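{- For $n$ a power of $2$, $$S_{(2\log n)\text{ -SR-I}}(\mathrm{bPHP}_n)=\mathcal{O}(n^2).$$
   Context: $\log$ is the binary logarithm. For $n$ a power of $2$, $\mathrm{bPHP}_n$ is the CNF in the variables $x_{i,j}$ ($1\le i\le n+1$, $1\le j\le \log n$) $$\bigwedge_{1\le i<j\le n+1,\ 0\le y<n}(\overline{x_{i,1}\ldots x_{i,\log n}}\ne y)\lor(\overline{x_{j,1}\ldots x_{j,\log n}}\ne y),$$ where $\overline{x_1\ldots x_m}$ is the integer with binary representation $x_1\ldots x_m$; each non-equality $(\overline{x_{i,1}\ldots x_{i,\log n}}\neq y)$ is written as the disjunction of $\log n$ literals expressing it. A clause is a disjunction (set) of literals. For $k\ge1$ (a constant or a function), a $k$-symmetry is a bijection $\phi$ of literals onto literals with $\phi(\lnot x)=\lnot\phi(x)$ and $\phi(x)=x$ for all variables $x$ except at most $k$ of them; it acts on clauses literal by literal. It is positive if it maps variables to variables (without negation). A $k$-SR-I proof (Resolution with global positive $k$-symmetries) of an unsatisfiable CNF $\Phi$ is a sequence of clauses ending with the empty clause, each of which is an input clause, or is obtained from earlier clauses by the resolution rule (from $A\lor x$ and $B\lor\lnot x$ infer $A\lor B$), or is obtained by the symmetry rule: if a clause $A$ was inferred earlier in the proof from $B_1,\dots,B_l$, and $\phi$ is a positive $k$-symmetry such that both sets $\{B_i\}$ and $\{\phi(B_i)\}$ are equal to the set of all input clauses, infer $\phi(A)$ in one step. There is no weakening rule. $S_\Pi(\Phi)$ is the number of steps in the shortest proof of $\Phi$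 in the proof system $\Pi$. -}

module Defs where

open import Data.Fin.Base using (Fin; zero; suc; finToFun)
open import Data.Fin.Properties using (_<?_)
open import Data.List.Base
  using (List; []; _∷_; _++_; map; length; filter; tabulate; allFin; cartesianProduct)
open import Data.List.Membership.Propositional as Propositional using ()
open import Data.List.Membership.Setoid as SetoidMembership using ()
open import Data.List.Relation.Binary.BagAndSetEquality using (_∼[_]_; [_]-Equality; set)
open import Data.List.Relation.Binary.Subset.Setoid as SetoidSubset using ()
open import Data.Nat.Base using (ℕ; suc; _^_; _≤_)
open import Data.Nat.Properties using (≤-trans)
open import Data.Product.Base using (Σ; ∃; _×_; _,_)
open import Function.Bundles using (_⤖_; _⇔_; mk⇔; module Bijection)
open import Relation.Binary.Bundles using (Setoid)
open import Relation.Binary.PropositionalEquality.Core using (_≡_; refl)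
open import Relation.Nullary.Negation.Core using (¬_)

data Literal (V : Set) : Set where
  pos neg : V → Literal V

negate : ∀ {V} → Literal V → Literal V
negate (pos x) = neg x
negate (neg x) = pos x

-- A clause is a finite set of literals: lists are always compared by
-- `_∼[ set ]_`, never by `_≡_`, so order and repetition are immaterial.
Clause : Set → Set
Clause V = List (Literal V)

CNF : Set → Set
CNF V = List (Clause V)

clauseSetoid : Set → Setoid _ _
clauseSetoid V = [ set ]-Equality (Literal V)

module _ {V : Set} where

  open SetoidMembership (clauseSetoid V) using (_∈_) public
  open SetoidSubset (clauseSetoid V) using (_⊆_)

  infix 4 _≋_

  _≋_ : CNF V → CNF V → Set
  Φ ≋ Ψ = Φ ⊆ Ψ × Ψ ⊆ Φ

  record IsPositiveSymmetry (k : ℕ) (φ : Literal V ⤖ Literal V) : Set where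
    open Bijection φ using (to)
    field
      commutes : ∀ l → to (negate l) ≡ negate (to l)
      moved    : ∃ λ (xs : List V) →
                   length xs ≤ k ×
                   (∀ x → ¬ (x Propositional.∈ xs) → to (pos x) ≡ pos x)
      positive : ∀ x → ∃ λ y → to (pos x) ≡ pos y

  act : Literal V ⤖ Literal V → Clause V → Clause V
  act φ = map (Bijection.to φ)

  -- `Step k Φ Γ C`: the clause C follows in one step of k-SR-I from the
  -- earlier clauses Γ of a proof from Φ.
  data Step (k : ℕ) (Φ : CNF V) (Γ : List (Clause V)) (C : Clause V) : Set where
    input      : C ∈ Φ → Step k Φ Γ C
    resolution : ∀ x A B →
                 (pos x ∷ A) ∈ Γ → (neg x ∷ B) ∈ Γ →
                 C ∼[ set ] (A ++ B) → Step k Φ Γ C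
    -- Every clause of Γ was inferred from Φ, so for a global symmetry, where
    -- the premises B₁, …, Bₗ are all the input clauses, the only remaining
    -- condition is that φ maps the set of input clauses onto itself.
    symmetry   : ∀ A φ →
                 A ∈ Γ → IsPositiveSymmetry k φ → map (act φ) Φ ≋ Φ →
                 C ∼[ set ] act φ A → Step k Φ Γ C

  -- The clauses of a derivation are listed with the latest one first.
  data Derivation (k : ℕ) (Φ : CNF V) : List (Clause V) → Set where
    []  : Derivation k Φ []
    _∷_ : ∀ {C Γ} → Step k Φ Γ C → Derivation k Φ Γ → Derivation k Φ (C ∷ Γ)

  record Proof (k : ℕ) (Φ : CNF V) : Set where
    field
      earlier    : List (Clause V)
      derivation : Derivation k Φ ([] ∷ earlier)

    steps : ℕ
    steps = suc (length earlier)

  open Proof public using (steps)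

  -- `IsS k Φ s` says that s is the value of S for k-SR-I at Φ.
  IsS : ℕ → CNF V → ℕ → Set
  IsS k Φ s = (Σ (Proof k Φ) λ π → steps π ≡ s) × (∀ (π : Proof k Φ) → s ≤ steps π)

  infix 4 S[_,_]≤_

  -- The inequality "S ≤ m", stated without computing the minimum; by `S≤⇔≤`
  -- it is the comparison of the minimum with m.
  S[_,_]≤_ : ℕ → CNF V → ℕ → Set
  S[ k , Φ ]≤ m = Σ (Proof k Φ) λ π → steps π ≤ m

  S≤⇔≤ : ∀ {k Φ s m} → IsS k Φ s → S[ k , Φ ]≤ m ⇔ s ≤ m
  S≤⇔≤ ((π , refl) , least) =
    mk⇔ (λ (ρ , ρ≤m) → ≤-trans (least ρ) ρ≤m) (λ s≤m → π , s≤m)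

-- Below, ℓ is log n, so n = 2 ^ ℓ. The variable (i , j) is bit j of pigeon i.
Var : ℕ → Set
Var ℓ = Fin (suc (2 ^ ℓ)) × Fin ℓ

differs : ∀ {V} → V → Fin 2 → Literal V
differs x zero       = pos x
differs x (suc zero) = neg x

-- `finToFun y` lists the base-2 digits of y, most significant first.
neq : ∀ ℓ → Fin (suc (2 ^ ℓ)) → Fin (2 ^ ℓ) → Clause (Var ℓ)
neq ℓ i y = tabulate λ j → differs (i , j) (finToFun y j)

bPHP : ∀ ℓ → CNF (Var ℓ)
bPHP ℓ = map (λ ((i , j) , y) → neq ℓ i y ++ neq ℓ j y)
             (cartesianProduct pairs (allFin (2 ^ ℓ)))
  where
  pigeons : List (Fin (suc (2 ^ ℓ)))
  pigeons = allFin (suc (2 ^ ℓ))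

  pairs : List (Fin (suc (2 ^ ℓ)) × Fin (suc (2 ^ ℓ)))
  pairs = filter (λ (i , j) → i <? j) (cartesianProduct pigeons pigeons)

-- Consider 2 ^ r + 1 pigeons whose holes agree on all bits from r on. Ask for
-- the next bit of one pigeon after another: once more than half of the crowd
-- answers 0, or more than half answers 1, a crowd of 2 ^ (r - 1) + 1 pigeons
-- shares a smaller cube. Up to pigeon symmetry only the numbers (a , b) of answers
-- 0 and 1 matter. If the pigeons answering 0 are kept at the start of the crowd and
-- those answering 1 at its end, each of the O(4 ^ r) states follows from its two
-- successors by one transposition of pigeons (moving 2 ℓ variables) and one
-- resolution. Only one crowd per cube has to be refuted, so the cost satisfies
-- T(r) = 2 T(r - 1) + O(4 ^ r), whence T(ℓ) = O(n ^ 2).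

module Submission where

open import Defs
open import Data.Fin.Base using (Fin; zero; suc; toℕ; fromℕ<; finToFun; funToFin) renaming (_<_ to _<ᶠ_)
open import Data.Fin.Permutation using (Permutation′; transpose; flip; _⟨$⟩ʳ_; _⟨$⟩ˡ_; inverseˡ; inverseʳ)
open import Data.Fin.Properties using (_≟_; _<?_; <-cmp; toℕ-injective; toℕ-fromℕ<; toℕ<n; finToFun-funToFin)
open import Data.List.Base using (List; []; _∷_; _++_; map; length; tabulate; allFin; cartesianProduct)
open import Data.List.Membership.Propositional as Prop using ()
open import Data.List.Membership.Propositional.Properties
  using (∈-map⁺; ∈-map⁻; ∈-++⁺ˡ; ∈-++⁺ʳ; ∈-++⁻; ∈-allFin;
         ∈-filter⁺; ∈-filter⁻; ∈-cartesianProduct⁺; ∈-cartesianProduct⁻)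
open import Data.List.Properties
  using (map-++; map-tabulate; tabulate-cong; map-cong; map-id; map-∘;
         length-++; length-map; length-tabulate)
open import Data.List.Relation.Binary.BagAndSetEquality using (_∼[_]_; set)
open import Data.List.Relation.Binary.Subset.Propositional using () renaming (_⊆_ to _⊑_)
open import Data.List.Relation.Unary.All as All using (All; []; _∷_)
open import Data.List.Relation.Unary.All.Properties as All using ()
open import Data.List.Relation.Unary.Any as Any using (here; there)
open import Data.Nat.Base using (ℕ; zero; suc; _+_; _*_; _∸_; _^_; _≤_; _<_; z≤n; s≤s)
open import Data.Nat.Properties as ℕ using ()
open import Data.Nat.Tactic.RingSolver using (solve-∀)
open import Data.Product.Base using (∃-syntax; _×_; _,_; map₁)
open import Data.Sum.Base using (_⊎_; inj₁; inj₂)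
open import Data.Vec.Functional using (updateAt)
open import Data.Vec.Functional.Properties using (updateAt-updates; updateAt-minimal)
open import Function.Base using (_∘_; id; const)
open import Function.Bundles using (_⤖_; mk⇔; mk↔ₛ′; module Bijection; module Equivalence)
open import Function.Properties.Inverse using (↔⇒⤖)
open import Relation.Binary.Definitions using (tri<; tri≈; tri>)
open import Relation.Binary.PropositionalEquality using (_≡_; _≢_; refl; sym; trans; cong; cong₂; subst; subst₂)
open import Relation.Nullary.Decidable using (yes; no)
open import Relation.Nullary.Negation.Core using (¬_; contradiction)

-- Subsumption and growing derivations.

infix 4 _⊢_

-- Working up to subsumption makes up for the missing weakening rule.
_⊢_ : ∀ {V} → List (Clause V) → (Literal V → Set) → Set
Γ ⊢ P = ∃[ C ] C Prop.∈ Γ × All P C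

-- Derivations are shared rather than tree-like: `c` charges only the clauses added on top of `Γ`,
-- and `extends` lets whatever was derived before be reused free of charge.
record Extension {V} k (Φ : CNF V) (c : ℕ) (Γ : List (Clause V)) (K : List (Clause V) → Set) : Set where
  constructor extension
  field
    {clauses}  : List (Clause V)
    derivation : Derivation k Φ clauses
    extends    : Γ ⊑ clauses
    length≤    : length clauses ≤ c + length Γ
    holds      : K clauses

module _ {V : Set} where

  ⊢-⊑ : ∀ {Γ Δ} {P : Literal V → Set} → Γ ⊑ Δ → Γ ⊢ P → Δ ⊢ P
  ⊢-⊑ Γ⊑Δ (C , C∈Γ , all) = C , Γ⊑Δ C∈Γ , all

  ⊢-weaken : ∀ {Γ} {P Q : Literal V → Set} → (∀ {l} → P l → Q l) → Γ ⊢ P → Γ ⊢ Q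
  ⊢-weaken P⇒Q (C , C∈Γ , all) = C , C∈Γ , All.map P⇒Q all

  set-≈ : {C D : Clause V} → C ⊑ D → D ⊑ C → C ∼[ set ] D
  set-≈ C⊑D D⊑C = mk⇔ C⊑D D⊑C

  set-trans : {C D E : Clause V} → C ∼[ set ] D → D ∼[ set ] E → C ∼[ set ] E
  set-trans C∼D D∼E = mk⇔ (Equivalence.to D∼E ∘ Equivalence.to C∼D)
                          (Equivalence.from C∼D ∘ Equivalence.from D∼E)

  ∈-respˡ : ∀ {Γ} {C D : Clause V} → D ∼[ set ] C → C Prop.∈ Γ → D ∈ Γ
  ∈-respˡ D∼C = Any.map λ { refl → D∼C }

  ∷-swap : ∀ l m {C D : Clause V} → C ⊑ (m ∷ D) → (l ∷ C) ⊑ (m ∷ l ∷ D)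
  ∷-swap l m C⊑ (here eq) = there (here eq)
  ∷-swap l m C⊑ (there x) with C⊑ x
  ... | here eq = here eq
  ... | there y = there (there y)

  ∷-dup : ∀ m {C D : Clause V} → C ⊑ (m ∷ D) → (m ∷ C) ⊑ (m ∷ D)
  ∷-dup m C⊑ (here eq) = here eq
  ∷-dup m C⊑ (there x) = C⊑ x

  -- The evidence itself marks the occurrences of the pivot `m`. Set equality merges them all into
  -- one head, the form that the resolution rule demands.
  extract : ∀ {m} {P : Literal V → Set} {C} → All (λ l → l ≡ m ⊎ P l) C →
            All P C ⊎ ∃[ A ] All P A × (m ∷ A) ∼[ set ] C
  extract [] = inj₁ []
  extract {m} (_∷_ {x = l} p ps) with p | extract ps
  ... | inj₁ refl | inj₁ all = inj₂ (_ , all , set-≈ id id)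
  ... | inj₁ refl | inj₂ (A , all , eq) =
    inj₂ (A , all , set-≈ (there ∘ Equivalence.to eq) (∷-dup m (Equivalence.from eq)))
  ... | inj₂ q | inj₁ all = inj₁ (q ∷ all)
  ... | inj₂ q | inj₂ (A , all , eq) =
    inj₂ (l ∷ A , q ∷ all , set-≈ back (∷-swap l m (Equivalence.from eq)))
    where
    back : (m ∷ l ∷ A) ⊑ (l ∷ _)
    back (here e)          = there (Equivalence.to eq (here e))
    back (there (here e))  = here e
    back (there (there x)) = there (Equivalence.to eq (there x))

-- Combinators for extending derivations.

module _ {V : Set} {k : ℕ} {Φ : CNF V} where

  infixl 1 _>>=_

  stay : ∀ {c Γ K} → Derivation k Φ Γ → K Γ → Extension k Φ c Γ K
  stay D h = extension D id (ℕ.m≤n+m _ _) h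

  add : ∀ {Γ C} {P : Literal V → Set} → Derivation k Φ Γ → Step k Φ Γ C → All P C →
        Extension k Φ 1 Γ (_⊢ P)
  add D step all = extension (step ∷ D) there ℕ.≤-refl (_ , here refl , all)

  _>>=_ : ∀ {c d Γ K L} → Extension k Φ c Γ K →
          (∀ {Δ} → Derivation k Φ Δ → Γ ⊑ Δ → K Δ → Extension k Φ d Δ L) →
          Extension k Φ (c + d) Γ L
  _>>=_ {c} {d} {Γ} (extension D Γ⊑Δ len h) f with f D Γ⊑Δ h
  ... | extension D′ Δ⊑Δ′ len′ h′ = extension D′ (Δ⊑Δ′ ∘ Γ⊑Δ) bound h′
    where
    open ℕ.≤-Reasoning
    bound : _ ≤ c + d + length Γ
    bound = begin
      _                    ≤⟨ len′ ⟩
      d + _                ≤⟨ ℕ.+-monoʳ-≤ d len ⟩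
      d + (c + length Γ)   ≡⟨ ℕ.+-assoc d c _ ⟨
      d + c + length Γ     ≡⟨ cong (_+ length Γ) (ℕ.+-comm d c) ⟩
      c + d + length Γ     ∎

  mapE : ∀ {c Γ K L} → (∀ {Δ} → Γ ⊑ Δ → K Δ → L Δ) → Extension k Φ c Γ K → Extension k Φ c Γ L
  mapE f (extension D Γ⊑Δ len h) = extension D Γ⊑Δ len (f Γ⊑Δ h)

  -- Descending induction from `suc m` down to `a`; `j` counts the rounds still to run and makes the
  -- recursion structural.
  iterate : ∀ {c m Γ} (K : ℕ → List (Clause V) → Set) →
            (∀ {Δ} a → a ≤ m → Γ ⊑ Δ → Derivation k Φ Δ → K (suc a) Δ → Extension k Φ c Δ (K a)) →
            ∀ j a → j + a ≡ suc m → Derivation k Φ Γ → K (suc m) Γ → Extension k Φ (j * c) Γ (K a)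
  iterate K f zero a refl D h = stay {K = K a} D h
  iterate {c} {m} {Γ} K f (suc j) a eq D h =
    subst (λ e → Extension k Φ e Γ (K a)) (ℕ.+-comm (j * c) c)
      (_>>=_ {K = K (suc a)} {L = K a} (iterate K f j (suc a) (trans (ℕ.+-suc j a) eq) D h)
        λ D′ Γ⊑Δ h′ → f a a≤m Γ⊑Δ D′ h′)
    where
    a≤m : a ≤ m
    a≤m = subst (a ≤_) (ℕ.suc-injective eq) (ℕ.m≤n+m a j)

  -- A premise in which the pivot does not occur already lies within `P` and is kept as the
  -- conclusion; otherwise one resolution removes the pivot from both.
  resolve : ∀ {Γ} {P : Literal V → Set} x → Derivation k Φ Γ →
            Γ ⊢ (λ l → l ≡ pos x ⊎ P l) → Γ ⊢ (λ l → l ≡ neg x ⊎ P l) →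
            Extension k Φ 1 Γ (_⊢ P)
  resolve {P = P} x D (C , C∈ , allC) (E , E∈ , allE) with extract allC | extract allE
  ... | inj₁ all | _ = stay {K = _⊢ P} D (C , C∈ , all)
  ... | inj₂ _ | inj₁ all = stay {K = _⊢ P} D (E , E∈ , all)
  ... | inj₂ (A , allA , eqA) | inj₂ (B , allB , eqB) =
    add D (resolution x A B (∈-respˡ eqA C∈) (∈-respˡ eqB E∈) (set-≈ id id)) (All.++⁺ allA allB)

  move : ∀ {Γ} {P Q : Literal V → Set} φ → IsPositiveSymmetry k φ → map (act φ) Φ ≋ Φ →
         (∀ {l} → P l → Q (Bijection.to φ l)) → Derivation k Φ Γ → Γ ⊢ P →
         Extension k Φ 1 Γ (_⊢ Q)
  move φ sym-φ global P⇒Q D (C , C∈ , all) =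
    add D (symmetry C φ (∈-respˡ (set-≈ id id) C∈) sym-φ global (set-≈ id id))
        (All.map⁺ (All.map P⇒Q all))

  -- A proof must end with the empty clause, so the clauses derived after it are dropped.
  truncate : ∀ {Γ} → Derivation k Φ Γ → [] Prop.∈ Γ → S[ k , Φ ]≤ length Γ
  truncate D@(_ ∷ _) (here refl) = record { derivation = D } , ℕ.≤-refl
  truncate (_ ∷ D) (there p) with truncate D p
  ... | π , le = π , ℕ.m≤n⇒m≤1+n le

-- Renaming of variables and the cost recurrence.

relabel : ∀ {V W : Set} → (V → W) → Literal V → Literal W
relabel f (pos x) = pos (f x)
relabel f (neg x) = neg (f x)

relabel-differs : ∀ {V W : Set} (f : V → W) x v → relabel f (differs x v) ≡ differs (f x) v
relabel-differs f x zero       = refl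
relabel-differs f x (suc zero) = refl

-- One input clause for a single hole. Otherwise two smaller crowds, and then a square grid of side
-- `2 ^ r + 1` with one transposition and one resolution per cell.
cost : ℕ → ℕ
cost zero    = 1
cost (suc r) = cost r + (cost r + suc (2 ^ r) * (suc (2 ^ r) * 2))

-- The constant 4 reproduces itself: with `h = 2 ^ r` and `h + 1 ≤ 2 h`, the two halves cost at most
-- `8 h²` and the grid at most `8 h²`, in total `4 (2 h)²`.
cost≤ : ∀ r → cost r ≤ 4 * (2 ^ r * 2 ^ r)
cost≤ zero    = s≤s z≤n
cost≤ (suc r) = begin
  cost r + (cost r + suc h * (suc h * 2))
    ≤⟨ ℕ.+-mono-≤ (cost≤ r) (ℕ.+-mono-≤ (cost≤ r) (ℕ.*-mono-≤ 1+h≤ (ℕ.*-monoˡ-≤ 2 1+h≤))) ⟩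
  4 * (h * h) + (4 * (h * h) + (h + h) * ((h + h) * 2))
    ≡⟨ identity h ⟩
  4 * (2 * h * (2 * h)) ∎
  where
  open ℕ.≤-Reasoning
  h = 2 ^ r
  1+h≤ : suc h ≤ h + h
  1+h≤ = ℕ.+-monoˡ-≤ h (ℕ.m^n>0 2 r)
  identity : ∀ h → 4 * (h * h) + (4 * (h * h) + (h + h) * ((h + h) * 2)) ≡ 4 * (2 * h * (2 * h))
  identity = solve-∀

-- Permutations of pigeons as global symmetries.

module _ {ℓ : ℕ} where

  Pigeon : Set
  Pigeon = Fin (suc (2 ^ ℓ))

  permute : Permutation′ (suc (2 ^ ℓ)) → Literal (Var ℓ) ⤖ Literal (Var ℓ)
  permute π = ↔⇒⤖ (mk↔ₛ′ (relabel (map₁ (π ⟨$⟩ʳ_))) (relabel (map₁ (π ⟨$⟩ˡ_))) invˡ invʳ)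
    where
    invˡ : ∀ l → relabel (map₁ (π ⟨$⟩ʳ_)) (relabel (map₁ (π ⟨$⟩ˡ_)) l) ≡ l
    invˡ (pos (i , j)) = cong (λ i → pos (i , j)) (inverseʳ π)
    invˡ (neg (i , j)) = cong (λ i → neg (i , j)) (inverseʳ π)
    invʳ : ∀ l → relabel (map₁ (π ⟨$⟩ˡ_)) (relabel (map₁ (π ⟨$⟩ʳ_)) l) ≡ l
    invʳ (pos (i , j)) = cong (λ i → pos (i , j)) (inverseˡ π)
    invʳ (neg (i , j)) = cong (λ i → neg (i , j)) (inverseˡ π)

  permute-inverse : ∀ π C → map (Bijection.to (permute π)) (map (Bijection.to (permute (flip π))) C) ≡ C
  permute-inverse π C = trans (sym (map-∘ C)) (trans (map-cong inv C) (map-id C))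
    where
    inv : ∀ l → Bijection.to (permute π) (Bijection.to (permute (flip π)) l) ≡ l
    inv (pos (i , j)) = cong (λ i → pos (i , j)) (inverseʳ π)
    inv (neg (i , j)) = cong (λ i → neg (i , j)) (inverseʳ π)

  act-neq : ∀ π i y → act (permute π) (neq ℓ i y) ≡ neq ℓ (π ⟨$⟩ʳ i) y
  act-neq π i y = trans (map-tabulate _ _) (tabulate-cong λ j → relabel-differs _ (i , j) (finToFun y j))

  clash : Pigeon → Pigeon → Fin (2 ^ ℓ) → Clause (Var ℓ)
  clash i j y = neq ℓ i y ++ neq ℓ j y

  act-clash : ∀ π i j y → act (permute π) (clash i j y) ≡ clash (π ⟨$⟩ʳ i) (π ⟨$⟩ʳ j) y
  act-clash π i j y = trans (map-++ _ (neq ℓ i y) _) (cong₂ _++_ (act-neq π i y) (act-neq π j y))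

  clash-sym : ∀ i j y → clash i j y ∼[ set ] clash j i y
  clash-sym i j y = set-≈ (++-swap (neq ℓ i y)) (++-swap (neq ℓ j y))
    where
    ++-swap : ∀ A {B : Clause (Var ℓ)} → (A ++ B) ⊑ (B ++ A)
    ++-swap A {B} x with ∈-++⁻ A x
    ... | inj₁ a = ∈-++⁺ʳ B a
    ... | inj₂ b = ∈-++⁺ˡ b

  clash-<∈ : ∀ {i j} y → i <ᶠ j → clash i j y Prop.∈ bPHP ℓ
  clash-<∈ {i} {j} y i<j = ∈-map⁺ _ (∈-cartesianProduct⁺
    (∈-filter⁺ (λ (i , j) → i <? j) (∈-cartesianProduct⁺ (∈-allFin i) (∈-allFin j)) i<j) (∈-allFin y))

  -- Only pairs with `i < j` are listed, but a permutation may reverse the order of two pigeons. As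
  -- sets of literals the two clauses agree.
  clash∈ : ∀ {i j} y → i ≢ j → clash i j y ∈ bPHP ℓ
  clash∈ {i} {j} y i≢j with <-cmp i j
  ... | tri< i<j _ _ = ∈-respˡ (set-≈ id id) (clash-<∈ y i<j)
  ... | tri≈ _ i≡j _ = contradiction i≡j i≢j
  ... | tri> _ _ j<i = ∈-respˡ (clash-sym i j y) (clash-<∈ y j<i)

  bPHP⁻ : ∀ {C} → C Prop.∈ bPHP ℓ → ∃[ i ] ∃[ j ] ∃[ y ] i <ᶠ j × C ≡ clash i j y
  bPHP⁻ C∈ with ∈-map⁻ _ C∈
  ... | ((i , j) , y) , ijy∈ , refl with ∈-cartesianProduct⁻ _ _ ijy∈
  ... | ij∈ , _ with ∈-filter⁻ (λ (i , j) → i <? j) {xs = cartesianProduct (allFin _) (allFin _)} ij∈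
  ... | _ , i<j = i , j , y , i<j , refl

  act∈ : ∀ π {C} → C Prop.∈ bPHP ℓ → act (permute π) C ∈ bPHP ℓ
  act∈ π C∈ with bPHP⁻ C∈
  ... | i , j , y , i<j , refl = subst (_∈ bPHP ℓ) (sym (act-clash π i j y)) (clash∈ y λ eq →
    ℕ.<⇒≢ i<j (cong toℕ (trans (sym (inverseˡ π)) (trans (cong (π ⟨$⟩ˡ_) eq) (inverseˡ π)))))

  act-cong : ∀ π {C D : Clause (Var ℓ)} → C ∼[ set ] D → act (permute π) C ∼[ set ] act (permute π) D
  act-cong π {C} {D} C∼D = set-≈ (map-⊑ (Equivalence.to C∼D)) (map-⊑ (Equivalence.from C∼D))
    where
    map-⊑ : ∀ {C D} → C ⊑ D → act (permute π) C ⊑ act (permute π) D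
    map-⊑ C⊑D x with ∈-map⁻ _ x
    ... | l , l∈ , refl = ∈-map⁺ _ (C⊑D l∈)

  -- Distinct pigeons have distinct images, which gives the forward inclusion. For the converse, the
  -- preimage of an input clause is found by acting with `flip π`.
  permute-global : ∀ π → map (act (permute π)) (bPHP ℓ) ≋ bPHP ℓ
  permute-global π = fwd , bwd
    where
    fwd : ∀ {C} → C ∈ map (act (permute π)) (bPHP ℓ) → C ∈ bPHP ℓ
    fwd C∈ with Prop.find C∈
    ... | D , D∈ , C∼D with ∈-map⁻ _ D∈
    ... | E , E∈ , refl = Any.map (set-trans C∼D) (act∈ π E∈)
    bwd : ∀ {C} → C ∈ bPHP ℓ → C ∈ map (act (permute π)) (bPHP ℓ)
    bwd C∈ with Prop.find C∈
    ... | D , D∈ , C∼D with Prop.find (act∈ (flip π) D∈)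
    ... | E , E∈ , D′∼E = ∈-respˡ (set-trans C∼D
      (subst (_∼[ set ] act (permute π) E) (permute-inverse π D) (act-cong π D′∼E))) (∈-map⁺ _ E∈)

  transpose-view : ∀ (a b i : Pigeon) → (i ≡ a × transpose a b ⟨$⟩ʳ i ≡ b) ⊎
    (i ≢ a × i ≡ b × transpose a b ⟨$⟩ʳ i ≡ a) ⊎ (i ≢ a × i ≢ b × transpose a b ⟨$⟩ʳ i ≡ i)
  transpose-view a b i with i ≟ a
  ... | yes i≡a = inj₁ (i≡a , refl)
  ... | no i≢a with i ≟ b
  ...   | yes i≡b = inj₂ (inj₁ (i≢a , i≡b , refl))
  ...   | no i≢b  = inj₂ (inj₂ (i≢a , i≢b , refl))

  transpose-symmetry : ∀ a b → IsPositiveSymmetry (2 * ℓ) (permute (transpose a b))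
  transpose-symmetry a b = record
    { commutes = λ { (pos _) → refl ; (neg _) → refl }
    -- The bits of the two exchanged pigeons, hence the bound `2 * ℓ`; the trailing `[]` matches
    -- `2 * ℓ` unfolding to `ℓ + (ℓ + 0)`.
    ; moved    = row a ++ (row b ++ []) , ℕ.≤-reflexive length-rows , fixes
    ; positive = λ _ → _ , refl
    }
    where
    row : Pigeon → List (Var ℓ)
    row i = map (i ,_) (allFin ℓ)
    length-row : ∀ i → length (row i) ≡ ℓ
    length-row i = trans (length-map _ (allFin ℓ)) (length-tabulate id)
    length-rows : length (row a ++ (row b ++ [])) ≡ 2 * ℓ
    length-rows = trans (length-++ (row a)) (cong₂ _+_ (length-row a)
      (trans (length-++ (row b)) (cong (_+ 0) (length-row b))))
    fixes : ∀ x → ¬ (x Prop.∈ row a ++ (row b ++ [])) → pos (map₁ (transpose a b ⟨$⟩ʳ_) x) ≡ pos x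
    fixes (i , j) x∉ with transpose-view a b i
    ... | inj₁ (refl , _) = contradiction (∈-++⁺ˡ (∈-map⁺ _ (∈-allFin j))) x∉
    ... | inj₂ (inj₁ (_ , refl , _)) = contradiction (∈-++⁺ʳ (row a) (∈-++⁺ˡ (∈-map⁺ _ (∈-allFin j)))) x∉
    ... | inj₂ (inj₂ (_ , _ , eq)) = cong (λ i → pos (i , j)) eq

  -- `L i j v` records that bit `j` of pigeon `i` is `v`, which is exactly when `differs (i , j) v`
  -- fails. So `Γ ⊢ Falsified L` says that some clause of `Γ` refutes the partial information `L`.
  data Falsified (L : Pigeon → Fin ℓ → Fin 2 → Set) : Literal (Var ℓ) → Set where
    falsified : ∀ {i j v} → L i j v → Falsified L (differs (i , j) v)

  transposeStep : ∀ {Γ L M} a b → (∀ {i j v} → L i j v → M (transpose a b ⟨$⟩ʳ i) j v) →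
                  Derivation (2 * ℓ) (bPHP ℓ) Γ → Γ ⊢ Falsified L →
                  Extension (2 * ℓ) (bPHP ℓ) 1 Γ (_⊢ Falsified M)
  transposeStep {L = L} {M} a b L⇒M =
    move (permute (transpose a b)) (transpose-symmetry a b) (permute-global (transpose a b)) moves
    where
    moves : ∀ {l} → Falsified L l → Falsified M (Bijection.to (permute (transpose a b)) l)
    moves (falsified {i} {j} {v} Lijv) =
      subst (Falsified M) (sym (relabel-differs _ (i , j) v)) (falsified (L⇒M Lijv))

  -- The pigeons s, …, s + 2 ^ r agree with the hole p on every bit from r on:
  -- 2 ^ r + 1 pigeons share a cube of 2 ^ r holes.
  data Crowd (p : Fin ℓ → Fin 2) (r s : ℕ) : Pigeon → Fin ℓ → Fin 2 → Set where
    crowd : ∀ {i j v} → s ≤ toℕ i → toℕ i ≤ s + 2 ^ r → r ≤ toℕ j → p j ≡ v → Crowd p r s i j v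

  -- Splitting a crowd on one bit.

  module Split (p : Fin ℓ → Fin 2) (bit : Fin ℓ) (s : ℕ) (s≤ : s + 2 ^ suc (toℕ bit) ≤ 2 ^ ℓ) where

    r = toℕ bit
    h = 2 ^ r
    top = s + 2 ^ suc r

    child : Fin 2 → Fin ℓ → Fin 2
    child v = updateAt p bit (const v)

    -- Of the crowd, the first a pigeons have 0 at the bit, and the last b have 1.
    data Grid (a b : ℕ) : Pigeon → Fin ℓ → Fin 2 → Set where
      known : ∀ {i j v} → s ≤ toℕ i → toℕ i ≤ top → suc r ≤ toℕ j → p j ≡ v → Grid a b i j v
      low   : ∀ {i} → s ≤ toℕ i → toℕ i < s + a → Grid a b i bit zero
      high  : ∀ {i} → top < toℕ i + b → toℕ i ≤ top → Grid a b i bit (suc zero)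

    G : ℕ → ℕ → List (Clause (Var ℓ)) → Set
    G a b = _⊢ Falsified (Grid a b)

    h+h≡ : s + h + h ≡ top
    h+h≡ = trans (ℕ.+-assoc s h h) (cong (λ e → s + (h + e)) (sym (ℕ.+-identityʳ h)))

    s+h≤top : s + h ≤ top
    s+h≤top = subst (s + h ≤_) h+h≡ (ℕ.m≤m+n (s + h) h)

    child-other : ∀ {v j} → j ≢ bit → child v j ≡ p j
    child-other {v} {j} j≢bit = updateAt-minimal j bit p j≢bit

    above : ∀ {j : Fin ℓ} → r ≤ toℕ j → j ≢ bit → suc r ≤ toℕ j
    above r≤j j≢bit = ℕ.≤∧≢⇒< r≤j (j≢bit ∘ sym ∘ toℕ-injective)

    -- One boundary of the grid: `h + 1` answers 0, from the pigeons `s` to `s + h`, contain the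
    -- whole crowd of the half cube. One refutation of it serves every `b`.
    zero-child : ∀ b {l} → Falsified (Crowd (child zero) r s) l → Falsified (Grid (suc h) b) l
    zero-child b (falsified {i} {j} (crowd s≤i i≤ r≤j refl)) with j ≟ bit
    ... | yes refl rewrite updateAt-updates bit {const zero} p =
      falsified (low s≤i (subst (toℕ i <_) (sym (ℕ.+-suc s h)) (s≤s i≤)))
    ... | no j≢bit = falsified (known s≤i (ℕ.≤-trans i≤ s+h≤top) (above r≤j j≢bit) (sym (child-other j≢bit)))

    -- The other boundary. The last `h + 1` pigeons run from `s + h` to `top`, which is why this
    -- crowd is placed at `s + h`.
    one-child : ∀ a {l} → Falsified (Crowd (child (suc zero)) r (s + h)) l → Falsified (Grid a (suc h)) l
    one-child a (falsified {i} {j} (crowd s+h≤i i≤ r≤j refl)) with j ≟ bit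
    ... | yes refl rewrite updateAt-updates bit {const (suc zero)} p =
      falsified (high (subst₂ _≤_ (trans (ℕ.+-suc (s + h) h) (cong suc h+h≡)) refl (ℕ.+-monoˡ-≤ (suc h) s+h≤i))
                      (subst (toℕ i ≤_) h+h≡ i≤))
    ... | no j≢bit = falsified (known (ℕ.≤-trans (ℕ.m≤m+n s h) s+h≤i) (subst (toℕ i ≤_) h+h≡ i≤)
                                      (above r≤j j≢bit) (sym (child-other j≢bit)))

    grid⇒crowd : ∀ {l} → Falsified (Grid 0 0) l → Falsified (Crowd p (suc r) s) l
    grid⇒crowd (falsified (known s≤i i≤ r<j eq)) = falsified (crowd s≤i i≤ r<j eq)
    grid⇒crowd (falsified (low {i} s≤i i<)) =
      contradiction s≤i (ℕ.<⇒≱ (subst (toℕ i <_) (ℕ.+-identityʳ s) i<))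
    grid⇒crowd (falsified (high {i} <i i≤)) =
      contradiction i≤ (ℕ.<⇒≱ (subst (top <_) (ℕ.+-identityʳ (toℕ i)) <i))

    module Cell (a b : ℕ) (a≤h : a ≤ h) (b≤h : b ≤ h) where

      b≤top : b ≤ top
      b≤top = ℕ.≤-trans b≤h (ℕ.≤-trans (ℕ.m≤n+m h s) s+h≤top)

      -- At most `2 h` of the `2 h + 1` pigeons have answered, so at least one is undecided.
      s+a≤top∸b : s + a ≤ top ∸ b
      s+a≤top∸b = ℕ.m+n≤o⇒m≤o∸n (s + a)
        (subst (s + a + b ≤_) h+h≡ (ℕ.+-mono-≤ (ℕ.+-monoʳ-≤ s a≤h) b≤h))

      first< : s + a < suc (2 ^ ℓ)
      first< = s≤s (ℕ.≤-trans s+a≤top∸b (ℕ.≤-trans (ℕ.m∸n≤m top b) s≤))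

      last< : top ∸ b < suc (2 ^ ℓ)
      last< = s≤s (ℕ.≤-trans (ℕ.m∸n≤m top b) s≤)

      -- The pigeons at the two ends of the segment still undecided at the bit.
      first last : Pigeon
      first = fromℕ< first<
      last  = fromℕ< last<

      first≡ : toℕ first ≡ s + a
      first≡ = toℕ-fromℕ< first<

      last≡ : toℕ last ≡ top ∸ b
      last≡ = toℕ-fromℕ< last<

      first≤last : toℕ first ≤ toℕ last
      first≤last = subst₂ _≤_ (sym first≡) (sym last≡) s+a≤top∸b

      s≤first : s ≤ toℕ first
      s≤first = subst (s ≤_) (sym first≡) (ℕ.m≤m+n s a)

      last≤top : toℕ last ≤ top
      last≤top = subst (_≤ top) (sym last≡) (ℕ.m∸n≤m top b)

      last+b≡top : toℕ last + b ≡ top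
      last+b≡top = trans (cong (_+ b) last≡) (ℕ.m∸n+n≡m b≤top)

      last≤ : ∀ {i} → top < i + suc b → toℕ last ≤ i
      last≤ {i} <i = ℕ.+-cancelʳ-≤ b _ _ (subst (_≤ i + b) (sym last+b≡top)
        (ℕ.≤-pred (subst (suc top ≤_) (ℕ.+-suc i b) <i)))

      -- The image of Grid a (suc b) under the transposition of first and last.
      data Moved : Pigeon → Fin ℓ → Fin 2 → Set where
        old : ∀ {i j v} → Grid a b i j v → Moved i j v
        new : Moved first bit (suc zero)

      -- The answers 0 lie before `first` and the old answers 1 after `last`, so they stay put; what
      -- is known concerns every pigeon of the crowd alike. Only the newest answer 1 travels, from
      -- `last` to `first`.
      moved : ∀ {i j v} → Grid a (suc b) i j v → Moved (transpose first last ⟨$⟩ʳ i) j v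
      moved {i} (known s≤i i≤ r<j eq) with transpose-view first last i
      ... | inj₁ (_ , e) rewrite e = old (known (ℕ.≤-trans s≤first first≤last) last≤top r<j eq)
      ... | inj₂ (inj₁ (_ , _ , e)) rewrite e = old (known s≤first (ℕ.≤-trans first≤last last≤top) r<j eq)
      ... | inj₂ (inj₂ (_ , _ , e)) rewrite e = old (known s≤i i≤ r<j eq)
      moved {i} (low s≤i i<) with transpose-view first last i
      ... | inj₁ (refl , _) = contradiction (subst (_< s + a) first≡ i<) (ℕ.<-irrefl refl)
      ... | inj₂ (inj₁ (_ , refl , _)) =
        contradiction (ℕ.<-≤-trans i< (ℕ.≤-trans (ℕ.≤-reflexive (sym first≡)) first≤last)) (ℕ.<-irrefl refl)
      ... | inj₂ (inj₂ (_ , _ , e)) rewrite e = old (low s≤i i<)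
      moved {i} (high <i i≤) with transpose-view first last i
      -- An answer 1 at `first` forces `last ≤ first`: a single pigeon is undecided and the
      -- transposition is trivial.
      ... | inj₁ (i≡first , e) = subst (λ i → Moved i bit (suc zero)) (sym (trans e last≡first)) new
        where
        last≡first : last ≡ first
        last≡first = toℕ-injective (ℕ.≤-antisym (subst (toℕ last ≤_) (cong toℕ i≡first) (last≤ <i)) first≤last)
      ... | inj₂ (inj₁ (_ , _ , e)) rewrite e = new
      ... | inj₂ (inj₂ (_ , i≢last , e)) rewrite e =
        old (high (subst (_< toℕ i + b) last+b≡top (ℕ.+-monoˡ-< b last<i)) i≤)
        where
        last<i : toℕ last < toℕ i
        last<i = ℕ.≤∧≢⇒< (last≤ <i) (i≢last ∘ sym ∘ toℕ-injective)

      -- The left premise asks about `first`, the right one about `last`. After the transposition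
      -- both ask about `first`, whose bit is then the pivot.
      cell : ∀ {Γ} → Derivation (2 * ℓ) (bPHP ℓ) Γ → G (suc a) b Γ → G a (suc b) Γ →
             Extension (2 * ℓ) (bPHP ℓ) 2 Γ (G a b)
      cell D left right =
        _>>=_ {K = _⊢ Falsified Moved} {L = G a b} (transposeStep first last moved D right) λ D′ Γ⊑Δ right′ →
          resolve (first , bit) D′ (⊢-weaken isLeft (⊢-⊑ Γ⊑Δ left)) (⊢-weaken isRight right′)
        where
        isRight : ∀ {l} → Falsified Moved l → l ≡ neg (first , bit) ⊎ Falsified (Grid a b) l
        isRight (falsified (old g)) = inj₂ (falsified g)
        isRight (falsified new)     = inj₁ refl
        isLeft : ∀ {l} → Falsified (Grid (suc a) b) l → l ≡ pos (first , bit) ⊎ Falsified (Grid a b) l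
        isLeft (falsified (known s≤i i≤ r<j eq)) = inj₂ (falsified (known s≤i i≤ r<j eq))
        isLeft (falsified (high <i i≤)) = inj₂ (falsified (high <i i≤))
        isLeft (falsified {i} (low s≤i i<)) with i ≟ first
        ... | yes refl = inj₁ refl
        ... | no i≢first = inj₂ (falsified (low s≤i (ℕ.≤∧≢⇒<
          (ℕ.≤-pred (subst (suc (toℕ i) ≤_) (ℕ.+-suc s a) i<))
          (λ eq → i≢first (toℕ-injective (trans eq (sym first≡)))))))

    Row : ℕ → List (Clause (Var ℓ)) → Set
    Row b Γ = ∀ a → a ≤ suc h → G a b Γ

    -- The cells are filled with `a` descending from `suc h`, where `zero-child` applies. Each uses
    -- its neighbour in the same row and the cell of row `suc b` with the same `a`.
    row : ∀ {Γ} b → b ≤ h → Derivation (2 * ℓ) (bPHP ℓ) Γ → Γ ⊢ Falsified (Crowd (child zero) r s) →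
          Row (suc b) Γ → Extension (2 * ℓ) (bPHP ℓ) (suc h * 2) Γ (Row b)
    row {Γ} b b≤h D zeros next =
      mapE (λ _ part a → part a z≤n) (iterate Part step (suc h) 0 (ℕ.+-identityʳ _) D end)
      where
      Part : ℕ → List (Clause (Var ℓ)) → Set
      Part a Δ = ∀ a′ → a ≤ a′ → a′ ≤ suc h → G a′ b Δ
      end : Part (suc h) Γ
      end a′ ≤a′ a′≤ with ℕ.≤-antisym ≤a′ a′≤
      ... | refl = ⊢-weaken (zero-child b) zeros
      step : ∀ {Δ} a → a ≤ h → Γ ⊑ Δ → Derivation (2 * ℓ) (bPHP ℓ) Δ → Part (suc a) Δ →
             Extension (2 * ℓ) (bPHP ℓ) 2 Δ (Part a)
      step {Δ} a a≤h Γ⊑Δ D′ part =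
        mapE {K = G a b} {L = Part a} extend
          (Cell.cell a b a≤h b≤h D′ (part (suc a) ℕ.≤-refl (s≤s a≤h)) (⊢-⊑ Γ⊑Δ (next a (ℕ.m≤n⇒m≤1+n a≤h))))
        where
        extend : ∀ {Δ′} → Δ ⊑ Δ′ → G a b Δ′ → Part a Δ′
        extend Δ⊑ g a′ a≤a′ a′≤ with ℕ.m≤n⇒m<n∨m≡n a≤a′
        ... | inj₁ a<a′ = ⊢-⊑ Δ⊑ (part a′ a<a′ a′≤)
        ... | inj₂ refl = g

    -- The rows are filled with `b` descending from `suc h`, where `one-child` applies, to the state
    -- `(0 , 0)` in which nobody has answered.
    split : ∀ {Γ} → Derivation (2 * ℓ) (bPHP ℓ) Γ →
            Γ ⊢ Falsified (Crowd (child zero) r s) → Γ ⊢ Falsified (Crowd (child (suc zero)) r (s + h)) →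
            Extension (2 * ℓ) (bPHP ℓ) (suc h * (suc h * 2)) Γ (_⊢ Falsified (Crowd p (suc r) s))
    split D zeros ones =
      mapE (λ _ rows → ⊢-weaken grid⇒crowd (rows 0 z≤n))
        (iterate Row (λ b b≤h Γ⊑Δ D′ next → row b b≤h D′ (⊢-⊑ Γ⊑Δ zeros) next)
          (suc h) 0 (ℕ.+-identityʳ _) D (λ a _ → ⊢-weaken (one-child a) ones))

  -- Recursion over cubes.

  single : ∀ {Γ} p s → s + 1 ≤ 2 ^ ℓ → Derivation (2 * ℓ) (bPHP ℓ) Γ →
           Extension (2 * ℓ) (bPHP ℓ) 1 Γ (_⊢ Falsified (Crowd p 0 s))
  single p s s+1≤ D =
    -- A cube of one hole: the input clause for the pigeons `s` and `s + 1` in the hole `p`.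
    add D (input (clash∈ (funToFin p) i≢i′))
      (All.++⁺ (occupies i s≤i (ℕ.≤-trans (ℕ.≤-reflexive i≡) (ℕ.m≤m+n s 1)))
               (occupies i′ (ℕ.≤-trans (ℕ.m≤m+n s 1) (ℕ.≤-reflexive (sym i′≡))) (ℕ.≤-reflexive i′≡)))
    where
    i i′ : Pigeon
    i  = fromℕ< (s≤s (ℕ.≤-trans (ℕ.m≤m+n s 1) s+1≤))
    i′ = fromℕ< (s≤s s+1≤)
    i≡ : toℕ i ≡ s
    i≡ = toℕ-fromℕ< _
    i′≡ : toℕ i′ ≡ s + 1
    i′≡ = toℕ-fromℕ< _
    s≤i : s ≤ toℕ i
    s≤i = ℕ.≤-reflexive (sym i≡)
    i≢i′ : i ≢ i′
    i≢i′ eq = ℕ.m≢1+m+n s (trans (trans (sym i≡) (trans (cong toℕ eq) i′≡))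
      (trans (ℕ.+-comm s 1) (cong suc (sym (ℕ.+-identityʳ s)))))
    occupies : ∀ i → s ≤ toℕ i → toℕ i ≤ s + 1 → All (Falsified (Crowd p 0 s)) (neq ℓ i (funToFin p))
    occupies i s≤i i≤ = All.tabulate⁺ λ j → falsified (crowd s≤i i≤ z≤n (sym (finToFun-funToFin p j)))

  refuteCrowd : ∀ {Γ} p r s → r ≤ ℓ → s + 2 ^ r ≤ 2 ^ ℓ → Derivation (2 * ℓ) (bPHP ℓ) Γ →
                Extension (2 * ℓ) (bPHP ℓ) (cost r) Γ (_⊢ Falsified (Crowd p r s))
  refuteCrowd p zero s _ s≤ D = single p s s≤ D
  -- Matching on `refl` turns `r` into `toℕ bit`, the form in which `Split` takes it.
  refuteCrowd p (suc r) s r<ℓ s≤ D with fromℕ< r<ℓ | toℕ-fromℕ< r<ℓ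
  ... | bit | refl =
    _>>=_ {K = _⊢ Falsified (Crowd (child zero) (toℕ bit) s)} {L = Goal}
      (refuteCrowd (child zero) (toℕ bit) s (ℕ.<⇒≤ r<ℓ) (ℕ.≤-trans s+h≤top s≤) D) λ D₁ _ zeros →
    _>>=_ {K = _⊢ Falsified (Crowd (child (suc zero)) (toℕ bit) (s + h))} {L = Goal}
      (refuteCrowd (child (suc zero)) (toℕ bit) (s + h) (ℕ.<⇒≤ r<ℓ) (ℕ.≤-trans (ℕ.≤-reflexive h+h≡) s≤) D₁)
      λ D₂ Δ⊑ ones →
    split D₂ (⊢-⊑ Δ⊑ zeros) ones
    where
    open Split p bit s s≤
    Goal : List (Clause (Var ℓ)) → Set
    Goal = _⊢ Falsified (Crowd p (suc (toℕ bit)) s)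

theorem15 : ∃[ c ] ∃[ n₀ ] ∀ (ℓ : ℕ) → let n = 2 ^ ℓ in n₀ ≤ n → S[ 2 * ℓ , bPHP ℓ ]≤ c * n ^ 2
-- All `2 ^ ℓ + 1` pigeons form a crowd in the full cube; `const zero` is a default value, as no bit
-- is fixed yet.
theorem15 = 4 , 0 , λ ℓ _ → finish ℓ (refuteCrowd (const zero) ℓ 0 ℕ.≤-refl ℕ.≤-refl [])
  where
  finish : ∀ ℓ → Extension (2 * ℓ) (bPHP ℓ) (cost ℓ) [] (_⊢ Falsified (Crowd (const zero) ℓ 0)) →
           S[ 2 * ℓ , bPHP ℓ ]≤ 4 * (2 ^ ℓ) ^ 2
  -- A literal in the final clause would belong to a bit with index at least `ℓ`, so the clause is
  -- empty.
  finish ℓ (extension D _ len (_ ∷ _ , _ , falsified (crowd {j = j} _ _ ℓ≤j _) ∷ _)) =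
    contradiction (ℕ.≤-trans (toℕ<n j) ℓ≤j) (ℕ.<-irrefl refl)
  finish ℓ (extension D _ len ([] , []∈ , _)) with truncate D []∈
  ... | π , π≤ = π , (begin
    steps π               ≤⟨ π≤ ⟩
    _                     ≤⟨ len ⟩
    cost ℓ + 0        ≡⟨ ℕ.+-identityʳ _ ⟩
    cost ℓ            ≤⟨ cost≤ ℓ ⟩
    4 * (2 ^ ℓ * 2 ^ ℓ)   ≡⟨ cong (λ e → 4 * (2 ^ ℓ * e)) (ℕ.*-identityʳ (2 ^ ℓ)) ⟨
    4 * (2 ^ ℓ) ^ 2       ∎)
    where open ℕ.≤-Reasoning
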